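{- Let $G$ be a graph having a looped vertex $v$. Then $\ker(G)$, $\ker(G*v)$, and $\ker(G+v)$ are such that precisely two of the three are equal, to say $K_1$, and the third, $K_2$, is such that $\dim(K_2)=\dim(K_1)+1$ and $K_1=\{X\in K_2\mid v\notin X\}$.
   Context: Graphs are finite and undirected, without parallel edges, but loops are allowed. A graph $G$ with vertex set $V$ is identified with its adjacency matrix, the symmetric $V\times V$ matrix $(a_{u,w})$ over $\mathbb{F}_2$ with $a_{u,w}=1$ iff $\{u,w\}$ is an edge (where $a_{u,u}=1$ iff $u$ has a loop). $\ker(G)$ is the null space over $\mathbb{F}_2$ of this adjacency matrix; vectors over $\mathbb{F}_2$ indexed by $V$ are identified with subsets of $V$ (their supports), so $\ker(G)$ is regarded as a family of subsets of $V$. $G+v$ (loop complementation on $v$) is the graph obtained from $G$ by toggling the presence of a loop at $v$. For a looped vertex $v$, $G*v$ (pivot, i.e., local complementation at $v$) is the graph obtained from $G$ by toggling adjacency among the neighbours of $v$: with $N_G(v)=\{w\in V\mid \{v,w\}\in E(G),\ w\neq v\}$, for all $x,y\in N_G(v)$ (with $x=y$ possible, so loops on neighbours are toggled as well), $\{x,y\}$ is an edge of $G*v$ iff $\{x,y\}$ is not an edge of $G$; all other edges and loops are left unchanged. -}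

module Defs where

open import Algebra.Bundles using (CommutativeRing)
open import Data.Bool.Base using (Bool; true; false; not; _∧_; if_then_else_)
open import Data.Bool.Properties using (∧-comm; xor-∧-commutativeRing)
open import Data.Fin.Base using (Fin)
open import Data.Fin.Properties using (_≟_)
open import Data.Fin.Subset using (Subset; _∉_; ⊥)
open import Data.Nat.Base using (ℕ; suc)
open import Data.Product.Base using (_×_; ∃-syntax; Σ-syntax)
open import Data.Vec.Base using (lookup; tabulate)
open import Data.Vec.Functional using (Vector)
open import Level using (0ℓ)
open import Relation.Binary.PropositionalEquality using (_≡_; cong₂)
open import Relation.Nullary.Decidable using (⌊_⌋)
open import Relation.Nullary.Negation using (¬_)
open import Relation.Unary using (Pred; _∩_; _≐_)

-- The field 𝔽₂ is Bool with _xor_ as addition and _∧_ as multiplication, so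
-- vectors over 𝔽₂ indexed by Fin n are literally subsets of Fin n.
module 𝔽₂ = CommutativeRing xor-∧-commutativeRing

open import Algebra.Properties.CommutativeMonoid.Sum 𝔽₂.+-commutativeMonoid public
  using (sum)

-- Loops are allowed: the diagonal of adj is unconstrained.
record Graph (n : ℕ) : Set where
  field
    adj     : Fin n → Fin n → Bool
    adj-sym : ∀ u w → adj u w ≡ adj w u

open Graph public

module _ {n : ℕ} where

  infixl 6 _+_
  infixl 7 _*_

  Looped : Graph n → Fin n → Set
  Looped G v = adj G v v ≡ true

  _+_ : Graph n → Fin n → Graph n
  (G + v) .adj x y = if ⌊ x ≟ v ⌋ ∧ ⌊ y ≟ v ⌋ then not (adj G x y) else adj G x y
  (G + v) .adj-sym x y = cong₂ (λ b e → if b then not e else e)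
    (∧-comm ⌊ x ≟ v ⌋ ⌊ y ≟ v ⌋) (adj-sym G x y)

  -- v itself is never in its own neighbourhood, even when it is looped.
  neighbour : Graph n → Fin n → Fin n → Bool
  neighbour G v w = adj G v w ∧ not ⌊ w ≟ v ⌋

  -- The formula makes sense for every v, but it is the pivot only when v is
  -- looped; loopedness is therefore a hypothesis wherever _*_ is used.
  _*_ : Graph n → Fin n → Graph n
  (G * v) .adj x y =
    if neighbour G v x ∧ neighbour G v y then not (adj G x y) else adj G x y
  (G * v) .adj-sym x y = cong₂ (λ b e → if b then not e else e)
    (∧-comm (neighbour G v x) (neighbour G v y)) (adj-sym G x y)

  ker : Graph n → Pred (Subset n) 0ℓ
  ker G X = ∀ u → sum (λ w → adj G u w ∧ lookup X w) ≡ false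

  lincomb : ∀ {d} → Vector Bool d → Vector (Subset n) d → Subset n
  lincomb c b = tabulate λ i → sum (λ j → c j ∧ lookup (b j) i)

  Span : ∀ {d} → Vector (Subset n) d → Pred (Subset n) 0ℓ
  Span b X = ∃[ c ] lincomb c b ≡ X

  -- ⊥ is the empty subset, i.e. the zero vector.
  LinearlyIndependent : ∀ {d} → Vector (Subset n) d → Set
  LinearlyIndependent b = ∀ c → lincomb c b ≡ ⊥ → ∀ j → c j ≡ false

  -- K is a linear subspace of dimension d, i.e. has a basis of d vectors.
  HasDim : Pred (Subset n) 0ℓ → ℕ → Set
  HasDim K d = Σ[ b ∈ Vector (Subset n) d ] LinearlyIndependent b × K ≐ Span b

  -- Of K, K′ and L, the first two are equal and L is not equal to them;
  -- K is K₁ and L is K₂.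
  TwoEqualThirdLarger : Fin n → (K K′ L : Pred (Subset n) 0ℓ) → Set
  TwoEqualThirdLarger v K K′ L =
      K ≐ K′
    × ¬ (K ≐ L)
    × (∃[ d ] HasDim K d × HasDim L (suc d))
    × K ≐ L ∩ (v ∉_)

{-# OPTIONS --safe #-}
-- For t : V → 𝔽₂ let S(t) be the space of all x with G x = x_v t. With a the
-- row of v, the kernels of G, G + v and G * v are S(0), S(e_v) and S(a + e_v),
-- and all three have the same part W with x_v = 0. So each of them is W or has
-- dimension dim W + 1, according to whether it contains an x with x_v = 1.
-- Since G is symmetric, such x ∈ S(t) and y ∈ S(t′) satisfy t · y = t′ · x,
-- which is violated by any two of the three spaces; so at most one of them is
-- larger than W. If S(0) = W, then e_v is orthogonal to ker G, so G z = e_v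
-- for some z: if z_v = 1 then z ∈ S(e_v), otherwise z + e_v ∈ S(a + e_v).
module Submission where

open import Defs
open import Algebra.Properties.Semiring.Sum 𝔽₂.semiring
  using (sum-cong-≗; sum-remove; sum-replicate-zero; ∑-distrib-+; ∑-comm;
         *-distribˡ-sum; *-distribʳ-sum)
open import Data.Bool.Base using (Bool; true; false; not; _∧_; _xor_; if_then_else_)
open import Data.Bool.Properties as Bool
  using (∧-comm; ∧-assoc; ∧-zeroʳ; ∧-identityʳ; ∧-distribˡ-xor; ∧-distribʳ-xor;
         xor-assoc; xor-comm; xor-same; xor-identityʳ; ¬-not)
open import Data.Fin.Base using (Fin; zero; suc; punchIn)
open import Data.Fin.Properties using (_≟_; all?; any?; punchInᵢ≢i)
open import Data.Fin.Subset using (Subset; _∈_; _∉_; ⊥)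
open import Data.Fin.Subset.Properties using (anySubset?; _∈?_)
open import Data.List.Base using (List; []; _∷_; allFin)
open import Data.List.Membership.Propositional using () renaming (_∈_ to _∈ₗ_)
open import Data.List.Membership.Propositional.Properties using (∈-allFin)
open import Data.List.Relation.Unary.Any using (here; there)
open import Data.Nat.Base using (ℕ; zero; suc)
open import Data.Product.Base using (_×_; _,_; ∃-syntax; proj₁; proj₂)
open import Data.Sum.Base using (_⊎_; inj₁; inj₂)
open import Data.Vec.Base using (lookup; tabulate; zipWith)
open import Data.Vec.Properties
  using (lookup∘tabulate; tabulate∘lookup; tabulate-cong; lookup-zipWith;
         lookup-replicate; lookup⇒[]=; []=⇒lookup)
open import Data.Vec.Functional as F using (Vector)
open import Function.Base using (_∘_)
open import Level using (0ℓ)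
open import Relation.Binary.PropositionalEquality
  using (_≡_; _≢_; _≗_; refl; sym; trans; cong; cong₂; subst; module ≡-Reasoning)
open import Relation.Nullary.Decidable using (yes; no; ⌊_⌋; _×-dec_; ¬?)
open import Relation.Nullary.Negation using (¬_; contradiction)
open import Relation.Unary using (Pred; Decidable; _∩_; _≐_)
open import Relation.Unary.Properties using (≐-sym; ≐-trans)

open ≡-Reasoning

private variable
  m n k d : ℕ

xor≡false⇒≡ : ∀ {p q} → p xor q ≡ false → p ≡ q
xor≡false⇒≡ {false} {false} _ = refl
xor≡false⇒≡ {true}  {true}  _ = refl

if-not : ∀ b e → (if b then not e else e) ≡ e xor b
if-not false e     = sym (xor-identityʳ e)
if-not true  false = refl
if-not true  true  = refl

-- Linear algebra over 𝔽₂

infix 8 _·_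
infixl 6 _⊞_ _⊕_

_·_ : Vector Bool n → Vector Bool n → Bool
x · y = sum (λ i → x i ∧ y i)

_⊞_ : Vector Bool n → Vector Bool n → Vector Bool n
(x ⊞ y) i = x i xor y i

·-congˡ : ∀ (x : Vector Bool n) {y z} → y ≗ z → x · y ≡ x · z
·-congˡ x y≗z = sum-cong-≗ (λ i → cong (x i ∧_) (y≗z i))

·-comm : ∀ (x y : Vector Bool n) → x · y ≡ y · x
·-comm x y = sum-cong-≗ (λ i → ∧-comm (x i) (y i))

·-congʳ : ∀ {x y} (z : Vector Bool n) → x ≗ y → x · z ≡ y · z
·-congʳ z x≗y = sum-cong-≗ (λ i → cong (_∧ z i) (x≗y i))

·-distribˡ-⊞ : ∀ (x y z : Vector Bool n) → x · (y ⊞ z) ≡ x · y xor x · z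
·-distribˡ-⊞ x y z = trans (sum-cong-≗ (λ i → ∧-distribˡ-xor (x i) (y i) (z i)))
  (∑-distrib-+ (λ i → x i ∧ y i) (λ i → x i ∧ z i))

·-distribʳ-⊞ : ∀ (x y z : Vector Bool n) → (x ⊞ y) · z ≡ x · z xor y · z
·-distribʳ-⊞ x y z = trans (sum-cong-≗ (λ i → ∧-distribʳ-xor (z i) (x i) (y i)))
  (∑-distrib-+ (λ i → x i ∧ z i) (λ i → y i ∧ z i))

·-scaleˡ : ∀ c (x y : Vector Bool n) → (λ i → c ∧ x i) · y ≡ c ∧ x · y
·-scaleˡ c x y = trans (sum-cong-≗ (λ i → ∧-assoc c (x i) (y i)))
  (sym (*-distribˡ-sum c (λ i → x i ∧ y i)))

·-zeroʳ : ∀ (x : Vector Bool n) → x · (λ _ → false) ≡ false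
·-zeroʳ {n} x = trans (sum-cong-≗ (λ i → ∧-zeroʳ (x i))) (sum-replicate-zero n)

-- The two finite sums are exchanged: x · (A y) is (Aᵀ x) · y. For a symmetric `A` this is the
-- self-adjointness behind `Hit-pairing`.
·-adjoint : ∀ (x : Vector Bool m) (A : Fin m → Fin n → Bool) (y : Vector Bool n) →
            x · (λ i → A i · y) ≡ (λ j → x · (λ i → A i j)) · y
·-adjoint x A y = begin
  sum (λ i → x i ∧ sum (λ j → A i j ∧ y j))
    ≡⟨ sum-cong-≗ (λ i → *-distribˡ-sum (x i) (λ j → A i j ∧ y j)) ⟩
  sum (λ i → sum (λ j → x i ∧ (A i j ∧ y j)))
    ≡⟨ ∑-comm (λ i j → x i ∧ (A i j ∧ y j)) ⟩
  sum (λ j → sum (λ i → x i ∧ (A i j ∧ y j)))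
    ≡⟨ sum-cong-≗ (λ j → sum-cong-≗ (λ i → sym (∧-assoc (x i) (A i j) (y j)))) ⟩
  sum (λ j → sum (λ i → (x i ∧ A i j) ∧ y j))
    ≡⟨ sum-cong-≗ (λ j → sym (*-distribʳ-sum (y j) (λ i → x i ∧ A i j))) ⟩
  sum (λ j → sum (λ i → x i ∧ A i j) ∧ y j) ∎

δ : Fin n → Vector Bool n
δ v w = ⌊ w ≟ v ⌋

δ-refl : ∀ (v : Fin n) → δ v v ≡ true
δ-refl v with v ≟ v
... | yes _  = refl
... | no v≢v = contradiction refl v≢v

δ-≢ : ∀ {v w : Fin n} → w ≢ v → δ v w ≡ false
δ-≢ {v = v} {w} w≢v with w ≟ v
... | yes w≡v = contradiction w≡v w≢v
... | no _    = refl

·-δ : ∀ (x : Vector Bool n) v → x · δ v ≡ x v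
·-δ {suc n} x v = begin
  x · δ v
    ≡⟨ sum-remove {i = v} (λ i → x i ∧ δ v i) ⟩
  (x v ∧ δ v v) xor sum (λ i → x (punchIn v i) ∧ δ v (punchIn v i))
    ≡⟨ cong₂ _xor_ (cong (x v ∧_) (δ-refl v))
         (·-congˡ (x ∘ punchIn v) (λ i → δ-≢ (punchInᵢ≢i v i))) ⟩
  (x v ∧ true) xor (x ∘ punchIn v) · (λ _ → false)
    ≡⟨ cong₂ _xor_ (∧-identityʳ (x v)) (·-zeroʳ (x ∘ punchIn v)) ⟩
  x v xor false
    ≡⟨ xor-identityʳ (x v) ⟩
  x v ∎

-- `InSpan` and `Separated` are the two sides of the Fredholm alternative: either b is a combination
-- of the vectors `c j`, or some functional vanishes on all of them but not on b.
InSpan : Vector (Vector Bool m) k → Vector Bool m → Set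
InSpan c b = ∃[ x ] ∀ i → (λ j → c j i) · x ≡ b i

Separated : Vector (Vector Bool m) k → Vector Bool m → Set
Separated c b = ∃[ y ] (∀ j → y · c j ≡ false) × y · b ≡ true

-- When y is orthogonal to the tail of c but not to the head h, the target b is
-- replaced by h ⊞ b, whose separating functional y′ is either good or becomes
-- good after adding y.
span-or-separate : ∀ k (c : Vector (Vector Bool m) k) b → InSpan c b ⊎ Separated c b
span-or-separate zero c b with any? (λ i → b i Bool.≟ true)
... | yes (i , bᵢ) = inj₂ (δ i , (λ ()) , trans (·-comm (δ i) b) (trans (·-δ b i) bᵢ))
... | no ∄i        = inj₁ ((λ ()) , λ i → sym (¬-not (λ bᵢ → ∄i (i , bᵢ))))
span-or-separate (suc k) c b with span-or-separate k (F.tail c) b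
... | inj₁ (x , cx) = inj₁ (false F.∷ x , λ i →
        trans (cong (_xor (λ j → F.tail c j i) · x) (∧-zeroʳ (c zero i))) (cx i))
... | inj₂ (y , y⊥ , yb) with y · c zero in yh
...   | false = inj₂ (y , (λ { zero → yh ; (suc j) → y⊥ j }) , yb)
...   | true with span-or-separate k (F.tail c) (c zero ⊞ b)
...     | inj₁ (x , cx) = inj₁ (true F.∷ x , λ i → begin
            (c zero i ∧ true) xor (λ j → F.tail c j i) · x
              ≡⟨ cong₂ _xor_ (∧-identityʳ (c zero i)) (cx i) ⟩
            c zero i xor (c zero i xor b i)
              ≡⟨ sym (xor-assoc (c zero i) (c zero i) (b i)) ⟩
            (c zero i xor c zero i) xor b i
              ≡⟨ cong (_xor b i) (xor-same (c zero i)) ⟩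
            b i ∎)
-- From y′ · h + y′ · b = 1, the value of y′ · b is 1 if y′ · h = 0, and 0 if y′ · h = 1.
...     | inj₂ (y′ , y′⊥ , y′hb) with y′ · c zero in y′h
                                    | trans (sym (·-distribˡ-⊞ y′ (c zero) b)) y′hb
...       | false | y′b = inj₂ (y′ , (λ { zero → y′h ; (suc j) → y′⊥ j }) , y′b)
...       | true  | y′b = inj₂ (y ⊞ y′
            , (λ { zero    → trans (·-distribʳ-⊞ y y′ (c zero)) (cong₂ _xor_ yh y′h)
                 ; (suc j) → trans (·-distribʳ-⊞ y y′ (c (suc j)))
                                   (cong₂ _xor_ (y⊥ j) (y′⊥ j)) })
            , trans (·-distribʳ-⊞ y y′ b) (cong₂ _xor_ yb (Bool.not-injective y′b)))

-- Subspaces of 𝔽₂ⁿ and their dimension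

lookup-ext : ∀ {X Y : Subset n} → lookup X ≗ lookup Y → X ≡ Y
lookup-ext {X = X} {Y} eq =
  trans (sym (tabulate∘lookup X)) (trans (tabulate-cong eq) (tabulate∘lookup Y))

∉⇒lookup : ∀ {i} {X : Subset n} → i ∉ X → lookup X i ≡ false
∉⇒lookup {i = i} {X} i∉X = ¬-not (i∉X ∘ lookup⇒[]= i X)

lookup⇒∉ : ∀ {i} {X : Subset n} → lookup X i ≡ false → i ∉ X
lookup⇒∉ Xᵢ i∈X with () ← trans (sym Xᵢ) ([]=⇒lookup i∈X)

_⊕_ : Subset n → Subset n → Subset n
_⊕_ = zipWith _xor_

lookup-⊕ : ∀ (X Y : Subset n) i → lookup (X ⊕ Y) i ≡ lookup X i xor lookup Y i
lookup-⊕ X Y i = lookup-zipWith _xor_ i X Y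

⊕-cancelˡ : ∀ (X Y : Subset n) → X ⊕ (X ⊕ Y) ≡ Y
⊕-cancelˡ X Y = lookup-ext λ i → begin
  lookup (X ⊕ (X ⊕ Y)) i
    ≡⟨ trans (lookup-⊕ X (X ⊕ Y) i) (cong (lookup X i xor_) (lookup-⊕ X Y i)) ⟩
  lookup X i xor (lookup X i xor lookup Y i)
    ≡⟨ sym (xor-assoc (lookup X i) (lookup X i) (lookup Y i)) ⟩
  (lookup X i xor lookup X i) xor lookup Y i
    ≡⟨ cong (_xor lookup Y i) (xor-same (lookup X i)) ⟩
  lookup Y i ∎

lookup-⊥ : ∀ (i : Fin n) → lookup ⊥ i ≡ false
lookup-⊥ i = lookup-replicate i false

lookup-lincomb : ∀ (c : Vector Bool d) (b : Vector (Subset n) d) i →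
                 lookup (lincomb c b) i ≡ c · (λ j → lookup (b j) i)
lookup-lincomb c b = lookup∘tabulate (λ i → c · (λ j → lookup (b j) i))

lincomb-∷ : ∀ (c : Vector Bool (suc d)) (Z : Subset n) b i →
  lookup (lincomb c (Z F.∷ b)) i ≡ (c zero ∧ lookup Z i) xor lookup (lincomb (F.tail c) b) i
lincomb-∷ c Z b i = trans (lookup-lincomb c (Z F.∷ b) i)
  (cong ((c zero ∧ lookup Z i) xor_) (sym (lookup-lincomb (F.tail c) b i)))

lincomb-∷-false : ∀ (c : Vector Bool (suc d)) (Z : Subset n) b → c zero ≡ false →
                  lincomb c (Z F.∷ b) ≡ lincomb (F.tail c) b
lincomb-∷-false c Z b c₀ = lookup-ext λ i → trans (lincomb-∷ c Z b i)
  (cong (λ e → (e ∧ lookup Z i) xor lookup (lincomb (F.tail c) b) i) c₀)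

lincomb-∷-true : ∀ (c : Vector Bool (suc d)) (Z : Subset n) b → c zero ≡ true →
                 lincomb c (Z F.∷ b) ≡ Z ⊕ lincomb (F.tail c) b
lincomb-∷-true c Z b c₀ = lookup-ext λ i → trans (lincomb-∷ c Z b i) (trans
  (cong (λ e → (e ∧ lookup Z i) xor lookup (lincomb (F.tail c) b) i) c₀)
  (sym (lookup-⊕ Z (lincomb (F.tail c) b) i)))

record IsSubspace (K : Pred (Subset n) 0ℓ) : Set where
  field
    ⊥-closed : K ⊥
    ⊕-closed : ∀ {X Y} → K X → K Y → K (X ⊕ Y)

open IsSubspace

∩∉-isSubspace : ∀ {K : Pred (Subset n) 0ℓ} i → IsSubspace K → IsSubspace (K ∩ (i ∉_))
∩∉-isSubspace i K-sub .⊥-closed = K-sub .⊥-closed , lookup⇒∉ (lookup-⊥ i)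
∩∉-isSubspace i K-sub .⊕-closed {X} {Y} (KX , i∉X) (KY , i∉Y) =
  K-sub .⊕-closed KX KY ,
  lookup⇒∉ (trans (lookup-⊕ X Y i) (cong₂ _xor_ (∉⇒lookup i∉X) (∉⇒lookup i∉Y)))

HasDim-resp-≐ : ∀ {K L : Pred (Subset n) 0ℓ} → K ≐ L → HasDim K d → HasDim L d
HasDim-resp-≐ K≐L (b , ind , K≐span) = b , ind , ≐-trans (≐-sym K≐L) K≐span

HasDim-zero : ∀ {K : Pred (Subset n) 0ℓ} → K ⊥ → (∀ {X} → K X → X ≡ ⊥) → HasDim K 0
HasDim-zero {n} {K} K⊥ K⊆⊥ = F.[] , (λ _ _ ()) ,
  (λ KX → F.[] , trans (lincomb-[] F.[]) (sym (K⊆⊥ KX))) ,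
  λ { (c , refl) → subst K (sym (lincomb-[] c)) K⊥ }
  where
  lincomb-[] : ∀ c → lincomb c F.[] ≡ ⊥ {n}
  lincomb-[] c = lookup-ext λ i → trans (lookup-lincomb c F.[] i) (sym (lookup-⊥ i))

-- `L` is the disjoint union of L₀ = `L ∩ (i ∉_)` and its coset `Z` + L₀, so putting `Z` in front of
-- a basis of L₀ gives a basis of `L`.
HasDim-extend : ∀ {L : Pred (Subset n) 0ℓ} {i Z} → IsSubspace L → L Z → i ∈ Z →
                HasDim (L ∩ (i ∉_)) d → HasDim L (suc d)
HasDim-extend {n} {d} {L} {i} {Z} L-sub LZ i∈Z (b , ind , L₀⊆span , span⊆L₀) =
  Z F.∷ b , ind′ , (λ {X} → to X) , λ { (c , refl) → from c refl }
  where
  Zᵢ : lookup Z i ≡ true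
  Zᵢ = []=⇒lookup i∈Z

  in-L₀ : ∀ c → (L ∩ (i ∉_)) (lincomb c b)
  in-L₀ c = span⊆L₀ (c , refl)

  ind′ : LinearlyIndependent (Z F.∷ b)
  ind′ c eq = λ { zero → c₀ ; (suc j) → ind (F.tail c) tail≡⊥ j }
    where
    -- Only `Z` contains `i`, so the coordinate `i` of the combination is the coefficient of `Z`.
    c₀ : c zero ≡ false
    c₀ = begin
      c zero
        ≡⟨ sym (trans (xor-identityʳ _) (∧-identityʳ (c zero))) ⟩
      (c zero ∧ true) xor false
        ≡⟨ cong₂ (λ p q → (c zero ∧ p) xor q) (sym Zᵢ)
             (sym (∉⇒lookup (proj₂ (in-L₀ (F.tail c))))) ⟩
      (c zero ∧ lookup Z i) xor lookup (lincomb (F.tail c) b) i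
        ≡⟨ sym (lincomb-∷ c Z b i) ⟩
      lookup (lincomb c (Z F.∷ b)) i
        ≡⟨ trans (cong (λ X → lookup X i) eq) (lookup-⊥ i) ⟩
      false ∎

    tail≡⊥ : lincomb (F.tail c) b ≡ ⊥
    tail≡⊥ = trans (sym (lincomb-∷-false c Z b c₀)) eq

  to : ∀ X → L X → Span (Z F.∷ b) X
  to X LX with i ∈? X
  ... | no i∉X = let c , eq = L₀⊆span (LX , i∉X) in
    false F.∷ c , trans (lincomb-∷-false (false F.∷ c) Z b refl) eq
  -- Adding `Z` clears the coordinate `i` and lands in L₀; adding `Z` once more recovers `X`.
  ... | yes i∈X =
    let c , eq = L₀⊆span (L-sub .⊕-closed LZ LX ,
                   lookup⇒∉ (trans (lookup-⊕ Z X i) (cong₂ _xor_ Zᵢ ([]=⇒lookup i∈X))))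
    in true F.∷ c , trans (lincomb-∷-true (true F.∷ c) Z b refl)
                          (trans (cong (Z ⊕_) eq) (⊕-cancelˡ Z X))

  from : ∀ c {c₀} → c zero ≡ c₀ → L (lincomb c (Z F.∷ b))
  from c {false} c₀ = subst L (sym (lincomb-∷-false c Z b c₀)) (proj₁ (in-L₀ (F.tail c)))
  from c {true}  c₀ = subst L (sym (lincomb-∷-true c Z b c₀))
    (L-sub .⊕-closed LZ (proj₁ (in-L₀ (F.tail c))))

-- The listed coordinates suffice to detect nonzero members of K; each of them
-- raises the dimension by at most one.
hasDim-via : ∀ {K : Pred (Subset n) 0ℓ} (is : List (Fin n)) → Decidable K → IsSubspace K →
             (∀ {X} → K X → (∀ {i} → i ∈ₗ is → i ∉ X) → X ≡ ⊥) → ∃[ d ] HasDim K d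
hasDim-via [] K? K-sub detect =
  0 , HasDim-zero (K-sub .⊥-closed) (λ KX → detect KX λ ())
hasDim-via (i ∷ is) K? K-sub detect
  with hasDim-via is (λ X → K? X ×-dec ¬? (i ∈? X)) (∩∉-isSubspace i K-sub)
         (λ { (KX , i∉X) h → detect KX λ { (here refl) → i∉X ; (there j∈) → h j∈ } })
     | anySubset? (λ X → K? X ×-dec (i ∈? X))
... | d , dim | yes (Z , KZ , i∈Z) = suc d , HasDim-extend K-sub KZ i∈Z dim
... | d , dim | no ∄Z =
  d , HasDim-resp-≐ (proj₁ , λ {X} KX → KX , λ i∈X → ∄Z (X , KX , i∈X)) dim

hasDim : ∀ {K : Pred (Subset n) 0ℓ} → Decidable K → IsSubspace K → ∃[ d ] HasDim K d
hasDim {n} K? K-sub = hasDim-via (allFin n) K? K-sub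
  (λ _ h → lookup-ext λ i → trans (∉⇒lookup (h (∈-allFin i))) (sym (lookup-⊥ i)))

-- The spaces S(t)

module _ (G : Graph n) (v : Fin n) where

  -- This is S(t). Scaling t by the coordinate of `X` at `v` keeps the system homogeneous, so that
  -- its solutions form a subspace.
  Sol : Vector Bool n → Pred (Subset n) 0ℓ
  Sol t X = ∀ u → adj G u · lookup X ≡ lookup X v ∧ t u

  Hit : Vector Bool n → Set
  Hit t = ∃[ x ] x v ≡ true × (∀ u → adj G u · x ≡ t u)

  Sol? : ∀ t → Decidable (Sol t)
  Sol? t X = all? (λ u → adj G u · lookup X Bool.≟ lookup X v ∧ t u)

  Sol-isSubspace : ∀ t → IsSubspace (Sol t)
  Sol-isSubspace t .⊥-closed u = begin
    adj G u · lookup ⊥      ≡⟨ ·-congˡ (adj G u) lookup-⊥ ⟩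
    adj G u · (λ _ → false) ≡⟨ ·-zeroʳ (adj G u) ⟩
    false                   ≡⟨ cong (_∧ t u) (sym (lookup-⊥ v)) ⟩
    lookup ⊥ v ∧ t u        ∎
  Sol-isSubspace t .⊕-closed {X} {Y} SX SY u = begin
    adj G u · lookup (X ⊕ Y)
      ≡⟨ ·-congˡ (adj G u) (lookup-⊕ X Y) ⟩
    adj G u · (lookup X ⊞ lookup Y)
      ≡⟨ ·-distribˡ-⊞ (adj G u) (lookup X) (lookup Y) ⟩
    adj G u · lookup X xor adj G u · lookup Y
      ≡⟨ cong₂ _xor_ (SX u) (SY u) ⟩
    (lookup X v ∧ t u) xor (lookup Y v ∧ t u)
      ≡⟨ sym (∧-distribʳ-xor (t u) (lookup X v) (lookup Y v)) ⟩
    (lookup X v xor lookup Y v) ∧ t u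
      ≡⟨ cong (_∧ t u) (sym (lookup-⊕ X Y v)) ⟩
    lookup (X ⊕ Y) v ∧ t u ∎

  -- When the coordinate at `v` is 0, the right-hand side vanishes whatever t is.
  Sol-transfer : ∀ t t′ X → lookup X v ≡ false → Sol t X → Sol t′ X
  Sol-transfer t t′ X Xᵥ SX u =
    trans (SX u) (trans (cong (_∧ t u) Xᵥ) (cong (_∧ t′ u) (sym Xᵥ)))

  Hit⇒Sol : ∀ {t} → Hit t → ∃[ X ] Sol t X × v ∈ X
  Hit⇒Sol {t} (x , xᵥ , Gx) =
    tabulate x ,
    (λ u → trans (·-congˡ (adj G u) (lookup∘tabulate x))
                 (trans (Gx u) (cong (_∧ t u) (sym Xᵥ)))) ,
    lookup⇒[]= v (tabulate x) Xᵥ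
    where
    Xᵥ : lookup (tabulate x) v ≡ true
    Xᵥ = trans (lookup∘tabulate x v) xᵥ

  ¬Hit⇒∉ : ∀ {t} → ¬ Hit t → ∀ X → Sol t X → lookup X v ≡ false
  ¬Hit⇒∉ {t} ¬hit X SX = ¬-not λ Xᵥ →
    ¬hit (lookup X , Xᵥ , λ u → trans (SX u) (cong (_∧ t u) Xᵥ))

  -- Without a hit, S(t) lies entirely in the part avoiding `v`, and that part is the same for all
  -- t.
  ¬Hit⇒≐ : ∀ {t} → ¬ Hit t → ∀ t′ → Sol t ≐ Sol t′ ∩ (v ∉_)
  ¬Hit⇒≐ {t} ¬hit t′ =
    (λ {X} SX → let Xᵥ = ¬Hit⇒∉ ¬hit X SX in Sol-transfer t t′ X Xᵥ SX , lookup⇒∉ Xᵥ) ,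
    λ {X} (SX , v∉X) → Sol-transfer t′ t X (∉⇒lookup v∉X) SX

  -- Both sides equal xᵀ G y: t · y = (G x) · y = x · (G y) = x · t′, by symmetry of `G`.
  Hit-pairing : ∀ {t t′} ((x , _) : Hit t) ((y , _) : Hit t′) → t · y ≡ t′ · x
  Hit-pairing {t} {t′} (x , _ , Gx) (y , _ , Gy) = begin
    t · y
      ≡⟨ ·-congʳ y (λ j → sym (Gx j)) ⟩
    (λ j → adj G j · x) · y
      ≡⟨ ·-congʳ y (λ j → trans (·-comm (adj G j) x) (·-congˡ x (adj-sym G j))) ⟩
    (λ j → x · (λ i → adj G i j)) · y
      ≡⟨ sym (·-adjoint x (adj G) y) ⟩
    x · (λ i → adj G i · y)
      ≡⟨ ·-congˡ x Gy ⟩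
    x · t′
      ≡⟨ ·-comm x t′ ⟩
    t′ · x ∎

  twoEqualThirdLarger : ∀ {t t′ t″ K K′ L} → K ≐ Sol t → K′ ≐ Sol t′ → L ≐ Sol t″ →
                        ¬ Hit t → ¬ Hit t′ → Hit t″ → TwoEqualThirdLarger v K K′ L
  twoEqualThirdLarger {t} {t′} {t″} K≐ K′≐ L≐ ¬h ¬h′ h =
    let Z , SZ , v∈Z = Hit⇒Sol h
        d , dim      = hasDim (Sol? t) (Sol-isSubspace t)
    in
    ≐-trans K≐ (≐-trans (≐-trans (¬Hit⇒≐ ¬h t″) (≐-sym (¬Hit⇒≐ ¬h′ t″))) (≐-sym K′≐)) ,
    -- `Z` contains `v` and lies in `L`, whereas no member of `K` contains `v`.
    (λ K≐L → lookup⇒∉ (¬Hit⇒∉ ¬h Z (proj₁ K≐ {Z} (proj₂ K≐L {Z} (proj₂ L≐ {Z} SZ)))) v∈Z) ,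
    (d , HasDim-resp-≐ (≐-sym K≐) dim ,
      HasDim-resp-≐ (≐-sym L≐)
        (HasDim-extend (Sol-isSubspace t″) SZ v∈Z (HasDim-resp-≐ (¬Hit⇒≐ ¬h t″) dim))) ,
    ≐-trans K≐ (≐-trans (¬Hit⇒≐ ¬h t″)
      ((λ (SX , v∉X) → proj₂ L≐ SX , v∉X) , λ (LX , v∉X) → proj₁ L≐ LX , v∉X))

  -- The three kernels as spaces S(t)

  -- Both graph operations add the rank-one matrix t tᵀ to the adjacency matrix: t is `δ v` for
  -- `G + v` and `neighbour G v` for `G * v`.
  row-update : ∀ (t : Vector Bool n) u x →
    (λ w → if t u ∧ t w then not (adj G u w) else adj G u w) · x ≡ adj G u · x xor (t u ∧ t · x)
  row-update t u x = begin
    (λ w → if t u ∧ t w then not (adj G u w) else adj G u w) · x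
      ≡⟨ ·-congʳ x (λ w → if-not (t u ∧ t w) (adj G u w)) ⟩
    (adj G u ⊞ (λ w → t u ∧ t w)) · x
      ≡⟨ ·-distribʳ-⊞ (adj G u) (λ w → t u ∧ t w) x ⟩
    adj G u · x xor (λ w → t u ∧ t w) · x
      ≡⟨ cong (adj G u · x xor_) (·-scaleˡ (t u) t x) ⟩
    adj G u · x xor (t u ∧ t · x) ∎

  δ-· : ∀ x → δ v · x ≡ x v
  δ-· x = trans (·-comm (δ v) x) (·-δ x v)

  ker-G : ker G ≐ Sol (λ _ → false)
  ker-G = (λ {X} h u → trans (h u) (sym (∧-zeroʳ (lookup X v)))) ,
          λ {X} h u → trans (h u) (∧-zeroʳ (lookup X v))

  ker-+ : ker (G + v) ≐ Sol (δ v)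
  ker-+ =
    (λ {X} h u → xor≡false⇒≡ (trans (sym (row X u)) (h u))) ,
    λ {X} h u → trans (row X u) (trans (cong (_xor (lookup X v ∧ δ v u)) (h u))
                                        (xor-same (lookup X v ∧ δ v u)))
    where
    row : ∀ X u → adj (G + v) u · lookup X ≡ adj G u · lookup X xor (lookup X v ∧ δ v u)
    row X u = trans (row-update (δ v) u (lookup X))
      (cong (adj G u · lookup X xor_)
        (trans (cong (δ v u ∧_) (δ-· (lookup X))) (∧-comm (δ v u) (lookup X v))))

  neighbour-self : neighbour G v v ≡ false
  neighbour-self = trans (cong (λ b → adj G v v ∧ not b) (δ-refl v)) (∧-zeroʳ (adj G v v))

  module _ (loop : Looped G v) where

    -- At `v` itself the loop makes the two summands cancel; elsewhere `δ v` is 0.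
    neighbour≗ : neighbour G v ≗ adj G v ⊞ δ v
    neighbour≗ w with w ≟ v
    ... | yes refl rewrite loop = refl
    ... | no _     = trans (∧-identityʳ _) (sym (xor-identityʳ _))

    neighbour-· : ∀ x → neighbour G v · x ≡ adj G v · x xor x v
    neighbour-· x = trans (·-congʳ x neighbour≗)
      (trans (·-distribʳ-⊞ (adj G v) (δ v) x) (cong (adj G v · x xor_) (δ-· x)))

    -- With t = `neighbour G v` and a the row of `v`, the update adds (a · x + x_v) t. Since t is 0
    -- at `v`, the equation of row `v` forces a · x = 0 in either space, and the added term becomes
    -- x_v t.
    ker-* : ker (G * v) ≐ Sol (neighbour G v)
    ker-* =
      (λ {X} h →
        let Gᵥ = trans (sym (trans (row X v) (trans (cong (λ b → adj G v · lookup X xor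
                   (b ∧ (adj G v · lookup X xor lookup X v))) neighbour-self)
                   (xor-identityʳ _)))) (h v)
        in λ u → xor≡false⇒≡ (trans (sym (row′ X Gᵥ u)) (h u))) ,
      λ {X} h u →
        let Gᵥ = trans (h v) (trans (cong (lookup X v ∧_) neighbour-self) (∧-zeroʳ _))
        in trans (row′ X Gᵥ u)
             (trans (cong (_xor (lookup X v ∧ neighbour G v u)) (h u))
                    (xor-same (lookup X v ∧ neighbour G v u)))
      where
      row : ∀ X u → adj (G * v) u · lookup X ≡
            adj G u · lookup X xor (neighbour G v u ∧ (adj G v · lookup X xor lookup X v))
      row X u = trans (row-update (neighbour G v) u (lookup X))
        (cong (λ b → adj G u · lookup X xor (neighbour G v u ∧ b)) (neighbour-· (lookup X)))

      row′ : ∀ X → adj G v · lookup X ≡ false → ∀ u → adj (G * v) u · lookup X ≡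
             adj G u · lookup X xor (lookup X v ∧ neighbour G v u)
      row′ X Gᵥ u = trans (row X u) (cong (adj G u · lookup X xor_)
        (trans (cong (λ b → neighbour G v u ∧ (b xor lookup X v)) Gᵥ)
               (∧-comm (neighbour G v u) (lookup X v))))

    -- Exactly one of the three spaces is hit

    -- The pairing would give 0 = 0 · y = e_v · x = x_v = 1.
    ¬Hit-0-δ : Hit (λ _ → false) → ¬ Hit (δ v)
    ¬Hit-0-δ hx@(x , xᵥ , _) hy@(y , _)
      with () ← trans (sym (trans (·-comm (λ _ → false) y) (·-zeroʳ y)))
                  (trans (Hit-pairing hx hy) (trans (δ-· x) xᵥ))

    -- The pairing would give 0 = (a + e_v) · x = (G x)_v + x_v = 0 + 1.
    ¬Hit-0-neighbour : Hit (λ _ → false) → ¬ Hit (neighbour G v)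
    ¬Hit-0-neighbour hx@(x , xᵥ , Gx) hy@(y , _)
      with () ← trans (sym (trans (·-comm (λ _ → false) y) (·-zeroʳ y)))
                  (trans (Hit-pairing hx hy)
                    (trans (neighbour-· x) (cong₂ _xor_ (Gx v) xᵥ)))

    -- The pairing would give 1 = y_v = (a + e_v) · x = (G x)_v + x_v = 1 + 1.
    ¬Hit-δ-neighbour : Hit (δ v) → ¬ Hit (neighbour G v)
    ¬Hit-δ-neighbour hx@(x , xᵥ , Gx) hy@(y , yᵥ , _)
      with () ← trans (sym (trans (δ-· y) yᵥ))
                  (trans (Hit-pairing hx hy)
                    (trans (neighbour-· x) (cong₂ _xor_ (trans (Gx v) (δ-refl v)) xᵥ)))

    some-Hit : Hit (λ _ → false) ⊎ Hit (δ v) ⊎ Hit (neighbour G v)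
    some-Hit with span-or-separate n (adj G) (δ v)
    -- A functional that vanishes on all rows is a kernel vector, and not vanishing on e_v means y_v
    -- = 1.
    ... | inj₂ (y , y⊥ , yδ) =
      inj₁ (y , trans (sym (·-δ y v)) yδ , λ u → trans (·-comm (adj G u) y) (y⊥ u))
    -- A combination of rows with coefficients z is G z, by symmetry.
    ... | inj₁ (z , zG) with z v in zᵥ
                           | (λ u → trans (·-congʳ z (adj-sym G u)) (zG u))
    ...   | true  | Gz = inj₂ (inj₁ (z , zᵥ , Gz))
    -- Adding e_v turns z_v into 1 and adds column `v`, which is a, to G z = e_v.
    ...   | false | Gz = inj₂ (inj₂ (z ⊞ δ v , cong₂ _xor_ zᵥ (δ-refl v) , λ u → begin
      adj G u · (z ⊞ δ v)               ≡⟨ ·-distribˡ-⊞ (adj G u) z (δ v) ⟩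
      adj G u · z xor adj G u · δ v     ≡⟨ cong₂ _xor_ (Gz u) (·-δ (adj G u) v) ⟩
      δ v u xor adj G u v               ≡⟨ cong (δ v u xor_) (adj-sym G u v) ⟩
      δ v u xor adj G v u               ≡⟨ xor-comm (δ v u) (adj G v u) ⟩
      adj G v u xor δ v u               ≡⟨ sym (neighbour≗ u) ⟩
      neighbour G v u                   ∎))

theorem7p1 : ∀ (n : ℕ) (G : Graph n) (v : Fin n) → Looped G v →
    TwoEqualThirdLarger v (ker G) (ker (G * v)) (ker (G + v))
    ⊎ TwoEqualThirdLarger v (ker G) (ker (G + v)) (ker (G * v))
    ⊎ TwoEqualThirdLarger v (ker (G * v)) (ker (G + v)) (ker G)
theorem7p1 n G v loop with some-Hit G v loop
-- In each case the space that is hit is K₂, and the pairing excludes a hit in the other two.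
... | inj₁ h = inj₂ (inj₂ (twoEqualThirdLarger G v (ker-* G v loop) (ker-+ G v) (ker-G G v)
        (¬Hit-0-neighbour G v loop h) (¬Hit-0-δ G v loop h) h))
... | inj₂ (inj₁ h) = inj₁ (twoEqualThirdLarger G v (ker-G G v) (ker-* G v loop) (ker-+ G v)
        (λ h₀ → ¬Hit-0-δ G v loop h₀ h) (¬Hit-δ-neighbour G v loop h) h)
... | inj₂ (inj₂ h) = inj₂ (inj₁ (twoEqualThirdLarger G v (ker-G G v) (ker-+ G v) (ker-* G v loop)
        (λ h₀ → ¬Hit-0-neighbour G v loop h₀ h) (λ h₁ → ¬Hit-δ-neighbour G v loop h₁ h) h))
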